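{- There is a data structure in the cell-probe model for $n$-vertex interval graphs given in universal interval representation that answers adjacency queries $\mathrm{adj}(u,v)$ with $O(1)$ cell probes and uses $\log_2(n!)+O(1)$ bits of space.
   Context: An interval graph has an interval $I_v$ of the real line for each vertex $v$, with $u,v$ adjacent iff $I_u\cap I_v\neq\emptyset$. A universal interval representation of an $n$-vertex interval graph is an interval representation in which every $i\in[n]$ is the left endpoint of exactly one interval; vertex $i$ is identified with $I_i=[i,e_i]$ with integer $e_i\in[i,n]$. In the cell-probe model (word size $\Theta(\log n)$), preprocessing and query algorithms have unlimited computational power and the query cost is the number of memory cells read, adaptively. -}

module Defs where

open import Data.Nat using (ℕ; zero; suc; _+_; _*_; _^_; _≤_; _<_; _<ᵇ_)
open import Data.Nat using (_!)
open import Data.Nat.Logarithm using (⌊log₂_⌋)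
open import Data.Fin using (Fin; toℕ)
open import Data.Vec using (Vec; tabulate; lookup)
open import Data.Bool using (Bool; true; false; if_then_else_)
open import Data.Product using (Σ; _×_; _,_)
open import Data.Fin using (fromℕ<)
open import Relation.Nullary using (yes; no)
open import Data.Nat using (_<?_)
open import Function.Bundles using (_⇔_)
open import Relation.Binary.PropositionalEquality using (_≡_)

-- Universal interval representation of an n-vertex interval graph
-- (0-indexed): vertex i has interval [i , e i] with i ≤ e i ≤ n-1.
-- Every point of {0..n-1} is the left endpoint of exactly one interval.
record UnivRep (n : ℕ) : Set where
  field
    e     : Fin n → Fin n
    e-ok  : (i : Fin n) → toℕ i ≤ toℕ (e i)
open UnivRep public

-- Adjacency in the interval graph: the intervals [u, e u] and [v, e v]
-- intersect (closed intervals with integer endpoints intersect iff they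
-- share an integer point).
Adj : {n : ℕ} → UnivRep n → Fin n → Fin n → Set
Adj R u v = Σ ℕ λ x →
  (toℕ u ≤ x × x ≤ toℕ (e R u)) × (toℕ v ≤ x × x ≤ toℕ (e R v))

-- Memory: a bit string of length s.  Cell j (word size w) consists of the
-- bits at positions j*w , … , j*w + w - 1 (positions ≥ s read as 0).
bitAt : {s : ℕ} → Vec Bool s → ℕ → Bool
bitAt {s} m p with p <? s
... | yes p<s = lookup m (fromℕ< p<s)
... | no  _   = false

cell : (w : ℕ) {s : ℕ} → Vec Bool s → ℕ → Vec Bool w
cell w m j = tabulate λ k → bitAt m (j * w + toℕ k)

-- Adaptive query algorithm in the cell-probe model: a decision tree that
-- probes (reads) cells of w bits; the index says at most d probes are made.
data DTree (w : ℕ) (A : Set) : ℕ → Set where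
  leaf  : {d : ℕ} → A → DTree w A d
  probe : {d : ℕ} → ℕ → (Vec Bool w → DTree w A d) → DTree w A (suc d)

run : {w : ℕ} {A : Set} {d : ℕ} {s : ℕ} → DTree w A d → Vec Bool s → A
run (leaf a) m = a
run {w} (probe j k) m = run (k (cell w m j)) m

-- A cell-probe data structure for n-vertex interval graphs in universal
-- interval representation, with word size w, using s bits of space and
-- answering adj(u,v) with at most t cell probes.  Preprocessing
-- (encode) is an arbitrary function (unlimited power).
record AdjStructure (n w s t : ℕ) : Set where
  field
    encode  : UnivRep n → Vec Bool s
    query   : Fin n → Fin n → DTree w Bool t
    correct : (R : UnivRep n) (u v : Fin n) →
              (run (query u v) (encode R) ≡ true) ⇔ Adj R u v

{-# OPTIONS --safe #-}

-- The vertices are listed in reverse, so that the q-th one carries a digit n-1-e in {0..q}, and the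
-- digits are grouped in blocks of four (the n mod 4 topmost ones apart), block p having
-- X = (4p+1)(4p+2)(4p+3)(4p+4) values.  Following Dodis, Pătraşcu and Thorup ("Changing base without
-- losing space"), a spill k in [Y] and a block x in [X] are stored as the M-bit word k C + x mod C,
-- and x / C is the spill handed on to the next smaller block.  A spill is readable from the one word
-- that follows it, hence a block from two consecutive words.  With T = 2(p+1)²+1 ≤ C ≤ 2T the rounding
-- costs a factor (1 + 1/T)² in space, and the product of these factors over all p converges.

module Submission where

open import Defs
open import Data.Nat using (ℕ; zero; suc; _+_; _*_; _^_; _∸_; _/_; _%_; _≤_; _<_; _!; NonZero; >-nonZero;
  z≤n; s≤s; s≤s⁻¹; _≤?_; _<?_; _≟_; _≤ᵇ_; _≡ᵇ_)
open import Data.Nat.Properties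
open import Data.Nat.DivMod
open import Data.Nat.Divisibility using (divides)
open import Data.Nat.Logarithm using (⌊log₂_⌋; ⌊log₂⌋-mono-≤; ⌊log₂[2^n]⌋≡n)
open import Data.Nat.Tactic.RingSolver using (solve-∀)
open import Data.Bool.Properties using (T-≡)
open import Data.Bool using (Bool; true; false; if_then_else_)
open import Data.Fin using (Fin; toℕ; fromℕ<; opposite)
open import Data.Fin.Properties using (toℕ<n; toℕ-fromℕ<; fromℕ<-toℕ; opposite-prop; opposite-involutive)
open import Data.Vec using (Vec; []; _∷_; _++_; tabulate)
open import Data.Vec.Properties using (lookup∘tabulate)
open import Data.Product using (Σ; _×_; _,_)
open import Function using (_∘_)
open import Function.Construct.Composition using (_⇔-∘_)
open import Function.Bundles using (_⇔_; mk⇔; Equivalence)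
open import Relation.Nullary using (yes; no; contradiction)
open import Relation.Binary.PropositionalEquality using (_≡_; refl; sym; trans; cong; cong₂; subst; module ≡-Reasoning)

-- Division with remainder and powers of two.

[m*n+o]/n≡m : ∀ m {n o} .{{_ : NonZero n}} → o < n → (m * n + o) / n ≡ m
[m*n+o]/n≡m m {n} {o} o<n = begin
  (m * n + o) / n    ≡⟨ +-distrib-/-∣ˡ o (divides m refl) ⟩
  m * n / n + o / n  ≡⟨ cong₂ _+_ (m*n/n≡m m n) (m<n⇒m/n≡0 o<n) ⟩
  m + 0              ≡⟨ +-identityʳ m ⟩
  m                  ∎
  where open ≡-Reasoning

[m*n+o]%n≡o : ∀ m {n o} .{{_ : NonZero n}} → o < n → (m * n + o) % n ≡ o
[m*n+o]%n≡o m {n} {o} o<n = begin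
  (m * n + o) % n  ≡⟨ cong (_% n) (+-comm (m * n) o) ⟩
  (o + m * n) % n  ≡⟨ [m+kn]%n≡m%n o m n ⟩
  o % n            ≡⟨ m<n⇒m%n≡m o<n ⟩
  o                ∎
  where open ≡-Reasoning

m/n*n+m%n≡m : ∀ m n .{{_ : NonZero n}} → m / n * n + m % n ≡ m
m/n*n+m%n≡m m n = trans (+-comm (m / n * n) (m % n)) (sym (m≡m%n+[m/n]*n m n))

m*n+o<p : ∀ {m n o p q} → m ≤ q → o < n → suc q * n ≤ p → m * n + o < p
m*n+o<p {m} {n} {o} {p} {q} m≤q o<n bound = begin-strict
  m * n + o  <⟨ +-monoʳ-< (m * n) o<n ⟩
  m * n + n  ≡⟨ +-comm (m * n) n ⟩
  suc m * n  ≤⟨ *-monoˡ-≤ n (s≤s m≤q) ⟩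
  suc q * n  ≤⟨ bound ⟩
  p          ∎
  where open ≤-Reasoning

n<2^[1+⌊log₂n⌋] : ∀ n → n < 2 ^ suc ⌊log₂ n ⌋
n<2^[1+⌊log₂n⌋] n = ≰⇒> λ 2^l≤n → <-irrefl refl (begin-strict
  ⌊log₂ n ⌋                      <⟨ n<1+n _ ⟩
  suc ⌊log₂ n ⌋                  ≡⟨ ⌊log₂[2^n]⌋≡n (suc ⌊log₂ n ⌋) ⟨
  ⌊log₂ (2 ^ suc ⌊log₂ n ⌋) ⌋    ≤⟨ ⌊log₂⌋-mono-≤ 2^l≤n ⟩
  ⌊log₂ n ⌋                      ∎)
  where open ≤-Reasoning

-- Induction on `n`: the power found so far is kept until the argument reaches it, and then doubled.
-- The upper bound says `2 ^ k < 2 * (n + 1)`, so less than one bit is wasted.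
nextPowerOf2 : ∀ n → Σ ℕ λ k → n < 2 ^ k × 2 ^ k ≤ 2 * n + 1
nextPowerOf2 zero = 0 , ≤-refl , ≤-refl
nextPowerOf2 (suc n) with nextPowerOf2 n
... | k , n<2^k , 2^k≤ with suc n <? 2 ^ k
...   | yes 1+n<2^k = k , 1+n<2^k , ≤-trans 2^k≤ (+-monoˡ-≤ 1 (*-monoʳ-≤ 2 (n≤1+n n)))
...   | no  1+n≮2^k = suc k , lower , ≤-trans (≤-reflexive (cong (2 *_) 2^k≡1+n)) (m≤m+n _ 1)
  where
  2^k≡1+n : 2 ^ k ≡ suc n
  2^k≡1+n = ≤-antisym (≮⇒≥ 1+n≮2^k) n<2^k
  lower : suc n < 2 ^ suc k
  lower rewrite 2^k≡1+n = s≤s (m≤n⇒m≤o+n n (m≤m+n (suc n) 0))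

-- Bit strings

bitAt-∷ : ∀ {s} b (v : Vec Bool s) q → bitAt (b ∷ v) (suc q) ≡ bitAt v q
bitAt-∷ {s} b v q with suc q <? suc s | q <? s
... | yes _   | yes _ = refl
... | yes q<s | no q≮s = contradiction (s≤s⁻¹ q<s) q≮s
... | no q≮s  | yes q<s = contradiction (s≤s q<s) q≮s
... | no _    | no _ = refl

bitAt-++ : ∀ {l s} (u : Vec Bool l) (v : Vec Bool s) q → bitAt (u ++ v) (l + q) ≡ bitAt v q
bitAt-++ []      v q = refl
bitAt-++ {suc l} (b ∷ u) v q = trans (bitAt-∷ b (u ++ v) (l + q)) (bitAt-++ u v q)

bitAt-tabulate : ∀ {s} (f : ℕ → Bool) {q} → q < s → bitAt {s} (tabulate (f ∘ toℕ)) q ≡ f q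
bitAt-tabulate {s} f {q} q<s with q <? s
... | yes q<s′ = trans (lookup∘tabulate (f ∘ toℕ) (fromℕ< q<s′)) (cong f (toℕ-fromℕ< q<s′))
... | no q≮s = contradiction q<s q≮s

-- The agreement runs over all `q`, also past the end of `v`, where `bitAt` is `false`. So it holds
-- by `refl` for a whole memory at offset 0, and passes to the right part of a concatenation with no
-- length bookkeeping.
_ContainsAt_∶_ : (ℕ → Bool) → ℕ → ∀ {s} → Vec Bool s → Set
f ContainsAt o ∶ v = ∀ q → f (o + q) ≡ bitAt v q

containsAt-tail : ∀ {f o s b} {v : Vec Bool s} → f ContainsAt o ∶ (b ∷ v) → f ContainsAt suc o ∶ v
containsAt-tail {f} {o} {b = b} {v} h q =
  trans (cong f (sym (+-suc o q))) (trans (h (suc q)) (bitAt-∷ b v q))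

containsAt-++ʳ : ∀ {f o l s} (u : Vec Bool l) {v : Vec Bool s} →
                 f ContainsAt o ∶ (u ++ v) → f ContainsAt (o + l) ∶ v
containsAt-++ʳ {f} {o} {l} u {v} h q =
  trans (cong f (+-assoc o l q)) (trans (h (l + q)) (bitAt-++ u v q))

toBits : (l : ℕ) → ℕ → Vec Bool l
toBits zero    m = []
toBits (suc l) m = (m % 2 ≡ᵇ 1) ∷ toBits l (m / 2)

-- Inverse to `toBits`, least significant bit first. It reads a bit function rather than a vector,
-- so it applies both to the memory and to the part of it known from probes.
window : (ℕ → Bool) → ℕ → ℕ → ℕ
window f o zero    = 0
window f o (suc l) = (if f o then 1 else 0) + 2 * window f (suc o) l

window-cong : ∀ {f g : ℕ → Bool} o l → (∀ q → o ≤ q → q < o + l → f q ≡ g q) →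
              window f o l ≡ window g o l
window-cong o zero    f≡g = refl
window-cong o (suc l) f≡g = cong₂ (λ b n → (if b then 1 else 0) + 2 * n)
  (f≡g o ≤-refl (m<m+n o (s≤s z≤n)))
  (window-cong (suc o) l λ q o<q q< → f≡g q (<⇒≤ o<q) (subst (q <_) (sym (+-suc o l)) q<))

lowBit : ∀ {r} → r < 2 → (if r ≡ᵇ 1 then 1 else 0) ≡ r
lowBit {0} _ = refl
lowBit {1} _ = refl
lowBit {suc (suc _)} (s≤s (s≤s ()))

window-toBits : ∀ {f s} {v : Vec Bool s} o l {m} → m < 2 ^ l →
                f ContainsAt o ∶ (toBits l m ++ v) → window f o l ≡ m
window-toBits o zero {zero} _ h = refl
window-toBits o zero {suc m} (s≤s ()) h
window-toBits {f} o (suc l) {m} m<2^l h = begin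
  (if f o then 1 else 0) + 2 * window f (suc o) l    ≡⟨ cong₂ (λ b n → (if b then 1 else 0) + 2 * n) head≡ tail≡ ⟩
  (if m % 2 ≡ᵇ 1 then 1 else 0) + 2 * (m / 2)        ≡⟨ cong₂ _+_ (lowBit (m%n<n m 2)) (*-comm 2 (m / 2)) ⟩
  m % 2 + m / 2 * 2                                  ≡⟨ m≡m%n+[m/n]*n m 2 ⟨
  m                                                  ∎
  where
  open ≡-Reasoning
  head≡ : f o ≡ (m % 2 ≡ᵇ 1)
  head≡ = trans (cong f (sym (+-identityʳ o))) (h 0)
  tail≡ : window f (suc o) l ≡ m / 2
  tail≡ = window-toBits (suc o) l (m<n*o⇒m/o<n (subst (m <_) (*-comm 2 (2 ^ l)) m<2^l))
            (containsAt-tail {f} {v = toBits l (m / 2) ++ _} h)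

-- Probing a window of the memory

module _ {w : ℕ} .{{_ : NonZero w}} where

  withCell : ℕ → Vec Bool w → (ℕ → Bool) → ℕ → Bool
  withCell j c f q with q / w ≟ j
  ... | yes _ = bitAt c (q % w)
  ... | no  _ = f q

  -- The contents of the cells read are handed on as a bit function. Unread positions default to
  -- `false`, which is harmless as long as the continuation looks only at covered positions.
  probeCells : ∀ {A d} (k j : ℕ) → ((ℕ → Bool) → DTree w A d) → DTree w A (k + d)
  probeCells zero    j cont = cont λ _ → false
  probeCells (suc k) j cont = probe j λ c → probeCells k (suc j) (cont ∘ withCell j c)

  probedCells : ∀ {s} (k j : ℕ) → Vec Bool s → ℕ → Bool
  probedCells zero    j m = λ _ → false
  probedCells (suc k) j m = withCell j (cell w m j) (probedCells k (suc j) m)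

  run-probeCells : ∀ {A d s} k j (cont : (ℕ → Bool) → DTree w A d) (m : Vec Bool s) →
                   run (probeCells k j cont) m ≡ run (cont (probedCells k j m)) m
  run-probeCells zero    j cont m = refl
  run-probeCells (suc k) j cont m = run-probeCells k (suc j) (cont ∘ withCell j (cell w m j)) m

  probedCells-bitAt : ∀ {s} k j (m : Vec Bool s) {q} → j ≤ q / w → q / w < j + k →
                      probedCells k j m q ≡ bitAt m q
  probedCells-bitAt zero j m j≤ <j = contradiction (subst (_ <_) (+-identityʳ j) <j) (≤⇒≯ j≤)
  probedCells-bitAt (suc k) j m {q} j≤ <j with q / w ≟ j
  ... | yes refl = trans (bitAt-tabulate (λ r → bitAt m (q / w * w + r)) (m%n<n q w))
                         (cong (bitAt m) (m/n*n+m%n≡m q w))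
  ... | no  q/w≢j = probedCells-bitAt k (suc j) m (≤∧≢⇒< j≤ (q/w≢j ∘ sym))
                      (subst (q / w <_) (+-suc j k) <j)

  -- A window of at most `k * w` bits need not start at a cell boundary, so it may meet `k + 1`
  -- cells.
  probeWindow : ∀ {A d} (k o l : ℕ) → (ℕ → DTree w A d) → DTree w A (suc k + d)
  probeWindow k o l cont = probeCells (suc k) (o / w) λ f → cont (window f o l)

  run-probeWindow : ∀ {A d s} k o l (cont : ℕ → DTree w A d) (m : Vec Bool s) → l ≤ k * w →
                    run (probeWindow k o l cont) m ≡ run (cont (window (bitAt m) o l)) m
  run-probeWindow k o l cont m l≤kw =
    trans (run-probeCells (suc k) (o / w) (λ f → cont (window f o l)) m)
          (cong (λ n → run (cont n) m) (window-cong o l λ q o≤q q<o+l →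
            probedCells-bitAt (suc k) (o / w) m (/-monoˡ-≤ w o≤q)
              (m<n*o⇒m/o<n (bound q<o+l))))
    where
    open ≤-Reasoning
    bound : ∀ {q} → q < o + l → q < (o / w + suc k) * w
    bound {q} q<o+l = begin-strict
      q                              <⟨ q<o+l ⟩
      o + l                          ≡⟨ cong (_+ l) (m/n*n+m%n≡m o w) ⟨
      o / w * w + o % w + l          ≤⟨ +-mono-≤ (+-monoʳ-≤ (o / w * w) (m%n≤n o w)) l≤kw ⟩
      o / w * w + w + k * w          ≡⟨ +-assoc (o / w * w) w (k * w) ⟩
      o / w * w + suc k * w          ≡⟨ *-distribʳ-+ w (o / w) (suc k) ⟨
      (o / w + suc k) * w            ∎

-- Mixed radix

-- The product (s+1)(s+2)...(s+k), which counts the digit strings on positions s to s+k-1 when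
-- position q has q+1 values.
radix : ℕ → ℕ → ℕ
radix s zero    = 1
radix s (suc k) = radix s k * suc (s + k)

pack : (ℕ → ℕ) → ℕ → ℕ → ℕ
pack d s zero    = 0
pack d s (suc k) = pack d s k * suc (s + k) + d (s + k)

unpack : ℕ → ℕ → ℕ → ℕ → ℕ
unpack s zero    x i = 0
unpack s (suc k) x i with i ≟ k
... | yes _ = x % suc (s + k)
... | no  _ = unpack s k (x / suc (s + k)) i

pack<radix : ∀ {d} → (∀ q → d q ≤ q) → ∀ s k → pack d s k < radix s k
pack<radix d≤ s zero = s≤s z≤n
pack<radix {d} d≤ s (suc k) = begin-strict
  pack d s k * suc (s + k) + d (s + k)  <⟨ m*n+o<p {pack d s k} ≤-refl (s≤s (d≤ (s + k))) ≤-refl ⟩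
  suc (pack d s k) * suc (s + k)        ≤⟨ *-monoˡ-≤ (suc (s + k)) (pack<radix d≤ s k) ⟩
  radix s k * suc (s + k)               ∎
  where open ≤-Reasoning

unpack-pack : ∀ {d} → (∀ q → d q ≤ q) → ∀ s k {i} → i < k → unpack s k (pack d s k) i ≡ d (s + i)
unpack-pack {d} d≤ s (suc k) {i} i<1+k with i ≟ k
... | yes refl = [m*n+o]%n≡o (pack d s k) (s≤s (d≤ (s + k)))
... | no  i≢k  = trans (cong (λ x → unpack s k x i) ([m*n+o]/n≡m (pack d s k) (s≤s (d≤ (s + k)))))
                       (unpack-pack d≤ s k (≤∧≢⇒< (s≤s⁻¹ i<1+k) i≢k))

radix≤ : ∀ {s} k b → s + k ≤ b → radix s k ≤ b ^ k
radix≤     zero    b _ = ≤-refl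
radix≤ {s} (suc k) b s+k≤b = begin
  radix s k * suc (s + k)  ≤⟨ *-mono-≤ (radix≤ k b (<⇒≤ s+k<b)) s+k<b ⟩
  b ^ k * b                ≡⟨ *-comm (b ^ k) b ⟩
  b * b ^ k                ∎
  where
  open ≤-Reasoning
  s+k<b : suc (s + k) ≤ b
  s+k<b = ≤-trans (≤-reflexive (sym (+-suc s k))) s+k≤b

!*radix : ∀ s k → s ! * radix s k ≡ (s + k) !
!*radix s zero = trans (*-identityʳ (s !)) (cong _! (sym (+-identityʳ s)))
!*radix s (suc k) = begin
  s ! * (radix s k * suc (s + k))  ≡⟨ *-assoc (s !) (radix s k) (suc (s + k)) ⟨
  s ! * radix s k * suc (s + k)    ≡⟨ cong (_* suc (s + k)) (!*radix s k) ⟩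
  (s + k) ! * suc (s + k)          ≡⟨ *-comm ((s + k) !) (suc (s + k)) ⟩
  suc (s + k) !                    ≡⟨ cong _! (+-suc s k) ⟨
  (s + suc k) !                    ∎
  where open ≡-Reasoning

-- Rounding a spill and a part of a block to whole bits.

-- The header's T, Y and C are suc t, suc y and suc c, so a spill is a number k ≤ y.
record Rounding (t y : ℕ) : Set where
  field
    width   : ℕ
    c       : ℕ
    t≤c     : t ≤ c
    c≤2t    : suc c ≤ 2 * suc t
    fits    : suc y * suc c ≤ 2 ^ width
    tight   : 2 ^ width ≤ suc (suc c) * suc y
    minimal : ∀ k → suc t * suc y ≤ 2 ^ k → width ≤ k

  scale : ℕ
  scale = suc c

open Rounding

abstract
 -- `2 ^ k` is the least power of two that is at least TY, and C is the quotient of `2 ^ k` by Y.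
 -- From TY ≤ `2 ^ k` < 2TY follows T ≤ C < 2T. Later arguments use the fields only, so the
 -- construction can stay abstract.
 rounding : ∀ t y → Rounding t y
 -- The argument is TY - 1, so the strict lower bound reads TY ≤ `2 ^ k`.
 rounding t y with nextPowerOf2 (y + t * suc y)
 ... | k , lower , upper = build (2 ^ k / suc y) t<C (m/n*n≤m (2 ^ k) (suc y)) 2^k≤
   where
   open ≤-Reasoning
   2^k<2ty : 2 ^ k < 2 * (suc t * suc y)
   2^k<2ty = begin-strict
     2 ^ k                        ≤⟨ upper ⟩
     2 * (y + t * suc y) + 1      <⟨ n<1+n _ ⟩
     suc (2 * (y + t * suc y) + 1) ≡⟨ lemma (y + t * suc y) ⟩
     2 * (suc t * suc y)          ∎
     where
     lemma : ∀ m → suc (2 * m + 1) ≡ 2 * suc m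
     lemma = solve-∀
   t<C : suc t ≤ 2 ^ k / suc y
   t<C = subst (_≤ 2 ^ k / suc y) (m*n/n≡m (suc t) (suc y)) (/-monoˡ-≤ (suc y) lower)
   2^k≤ : 2 ^ k ≤ suc (2 ^ k / suc y) * suc y
   2^k≤ = begin
     2 ^ k                                        ≡⟨ m≡m%n+[m/n]*n (2 ^ k) (suc y) ⟩
     2 ^ k % suc y + 2 ^ k / suc y * suc y        ≤⟨ +-monoˡ-≤ _ (m%n≤n (2 ^ k) (suc y)) ⟩
     suc (2 ^ k / suc y) * suc y                  ∎
   build : ∀ C → suc t ≤ C → C * suc y ≤ 2 ^ k → 2 ^ k ≤ suc C * suc y → Rounding t y
   build (suc c) t<C C*y≤ 2^k≤ = record
     { width   = k
     ; c       = c
     ; t≤c     = s≤s⁻¹ t<C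
     ; c≤2t    = <⇒≤ (*-cancelʳ-< (suc y) (suc c) (2 * suc t)
                   (≤-<-trans C*y≤ (subst (2 ^ k <_) (sym (*-assoc 2 (suc t) (suc y))) 2^k<2ty)))
     ; fits    = subst (_≤ 2 ^ k) (*-comm (suc c) (suc y)) C*y≤
     ; tight   = 2^k≤
     ; minimal = λ j ty≤2^j → ≮⇒≥ λ j<k → <-irrefl refl
                   (<-≤-trans 2^k<2ty (≤-trans (*-monoʳ-≤ 2 ty≤2^j) (^-monoʳ-≤ 2 j<k)))
     }

-- Rounding C down costs at most a factor (C+1)/C, and rounding the number of spills up costs at
-- most (x+C)/x. Both are at most 1 + 1/T: the first since T ≤ C, the second since TC ≤ 2T² ≤ `x`.
rounding-loss : ∀ {t y x} (r : Rounding t y) → 2 * (suc t * suc t) ≤ x →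
  -- The extra factor `C` clears the division: `x / C * C` is at most `x`.
  suc t * suc t * (2 ^ width r * suc (x / scale r)) ≤ suc (suc t) * suc (suc t) * (x * suc y)
rounding-loss {t} {y} {x} r 2t²≤x = *-cancelʳ-≤ _ _ C (begin
  T * T * (2 ^ width r * suc (x / C)) * C          ≡⟨ lemma₁ T (2 ^ width r) (suc (x / C)) C ⟩
  (T * T) * (2 ^ width r * (suc (x / C) * C))      ≤⟨ *-monoʳ-≤ (T * T) (*-mono-≤ (tight r) (+-monoʳ-≤ C (m/n*n≤m x C))) ⟩
  (T * T) * (suc C * suc y * (C + x))              ≡⟨ lemma₂ T C y x ⟩
  (T * C + T) * (T * C + T * x) * suc y            ≤⟨ *-monoˡ-≤ (suc y) (*-mono-≤ (+-monoʳ-≤ (T * C) (s≤s (t≤c r))) (+-monoˡ-≤ (T * x) TC≤x)) ⟩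
  (T * C + C) * (x + T * x) * suc y                ≡⟨ lemma₃ T C y x ⟩
  suc T * suc T * (x * suc y) * C                  ∎)
  where
  open ≤-Reasoning
  T C : ℕ
  T = suc t
  C = scale r
  TC≤x : T * C ≤ x
  TC≤x = ≤-trans (*-monoʳ-≤ T (c≤2t r)) (≤-trans (≤-reflexive (lemma₀ T)) 2t²≤x)
    where
    lemma₀ : ∀ T → T * (2 * T) ≡ 2 * (T * T)
    lemma₀ = solve-∀
  lemma₁ : ∀ T M Z C → T * T * (M * Z) * C ≡ (T * T) * (M * (Z * C))
  lemma₁ = solve-∀
  lemma₂ : ∀ T C y x → (T * T) * (suc C * suc y * (C + x)) ≡ (T * C + T) * (T * C + T * x) * suc y
  lemma₂ = solve-∀
  lemma₃ : ∀ T C y x → (T * C + C) * (x + T * x) * suc y ≡ suc T * suc T * (x * suc y) * C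
  lemma₃ = solve-∀

-- The chain of words.

-- Quadratic growth makes the sum of the losses 1/T converge, while 2T² still stays below the
-- quartic number of values of a block of four digits.
slack : ℕ → ℕ
slack p = 2 * (p * p)

roundingAt : ∀ p y → Rounding (slack p) y
roundingAt p y = rounding (slack p) y

nextSpill : ℕ → ℕ → ℕ
nextSpill p y = radix (4 * p) 4 / scale (roundingAt (suc p) y)

mutual
  -- Lengths depend on `p` and the spill bound `y` alone, never on the data, so a query knows every
  -- offset without probing. The split into head and rest lets the encoding be a concatenation by
  -- definition for every `p`.
  chainLength : ℕ → ℕ → ℕ
  chainLength p y = width (roundingAt p y) + restLength p y

  restLength : ℕ → ℕ → ℕ
  restLength zero    y = 0
  restLength (suc p) y = chainLength p (nextSpill p y)

headWord : (p y k : ℕ) → (ℕ → ℕ) → ℕ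
-- The last word closes the chain with a spill and no block; the remainder 0 keeps the shape that
-- division by the scale decodes.
headWord zero    y k x = k * scale (roundingAt zero y) + 0
headWord (suc p) y k x = k * scale (roundingAt (suc p) y) + x p % scale (roundingAt (suc p) y)

mutual
  encodeChain : (p y k : ℕ) → (ℕ → ℕ) → Vec Bool (chainLength p y)
  encodeChain p y k x = toBits (width (roundingAt p y)) (headWord p y k x) ++ encodeRest p y x

  encodeRest : (p y : ℕ) → (ℕ → ℕ) → Vec Bool (restLength p y)
  encodeRest zero    y x = []
  encodeRest (suc p) y x = encodeChain p (nextSpill p y) (x p / scale (roundingAt (suc p) y)) x

headWord<2^width : ∀ p {y k} x → k ≤ y → headWord p y k x < 2 ^ width (roundingAt p y)
headWord<2^width zero    {y} x k≤y = m*n+o<p k≤y (s≤s z≤n) (fits (roundingAt zero y))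
headWord<2^width (suc p) {y} x k≤y = m*n+o<p k≤y (m%n<n (x p) _) (fits (roundingAt (suc p) y))

headWord/scale : ∀ p {y k} x → headWord p y k x / scale (roundingAt p y) ≡ k
headWord/scale zero    {y} {k} x = [m*n+o]/n≡m k (s≤s z≤n)
headWord/scale (suc p) {y} {k} x = [m*n+o]/n≡m k (m%n<n (x p) (scale (roundingAt (suc p) y)))

window-headWord : ∀ {f o} p {y k} x → k ≤ y → f ContainsAt o ∶ encodeChain p y k x →
                  window f o (width (roundingAt p y)) ≡ headWord p y k x
window-headWord {o = o} p {y} x k≤y h =
  window-toBits {v = encodeRest p y x} o (width (roundingAt p y)) (headWord<2^width p x k≤y) h

containsAt-rest : ∀ {f o} p {y k} x → f ContainsAt o ∶ encodeChain (suc p) y k x →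
  f ContainsAt (o + width (roundingAt (suc p) y)) ∶
    encodeChain p (nextSpill p y) (x p / scale (roundingAt (suc p) y)) x
containsAt-rest {f} {o} p {y} {k} x =
  containsAt-++ʳ {f} {o} (toBits (width (roundingAt (suc p) y)) (headWord (suc p) y k x))

-- Words have a logarithmic number of bits.

module Widths (L : ℕ) where

  radix≤2^ : ∀ {s k} → k ≤ 4 → s + k ≤ 2 ^ L → radix s k ≤ 2 ^ (L * 4)
  radix≤2^ {s} {k} k≤4 s+k≤N = begin
    radix s k      ≤⟨ radix≤ k (2 ^ L) s+k≤N ⟩
    (2 ^ L) ^ k    ≡⟨ ^-*-assoc 2 L k ⟩
    2 ^ (L * k)    ≤⟨ ^-monoʳ-≤ 2 (*-monoʳ-≤ L k≤4) ⟩
    2 ^ (L * 4)    ∎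
    where open ≤-Reasoning

  4[1+p]≤⇒4p+4≤ : ∀ p → 4 * suc p ≤ 2 ^ L → 4 * p + 4 ≤ 2 ^ L
  4[1+p]≤⇒4p+4≤ p = subst (_≤ 2 ^ L) (trans (*-suc 4 p) (+-comm 4 (4 * p)))

  nextSpill≤ : ∀ p y → 4 * suc p ≤ 2 ^ L → nextSpill p y ≤ 2 ^ (L * 4)
  nextSpill≤ p y 4p≤N = ≤-trans (m/n≤m (radix (4 * p) 4) (scale (roundingAt (suc p) y))) (radix≤2^ ≤-refl (4[1+p]≤⇒4p+4≤ p 4p≤N))

  -- With N = `2 ^ L`, T is at most 3N² and Y at most 2N⁴. Hence TY ≤ 6N⁶, which is padded to the
  -- power of two 8N⁶ so that `minimal` applies.
  width≤ : ∀ p y → 4 * p ≤ 2 ^ L → y ≤ 2 ^ (L * 4) → width (roundingAt p y) ≤ 3 + L * 6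
  width≤ p y 4p≤N y≤N⁴ = minimal (roundingAt p y) (3 + L * 6) (begin
    suc (slack p) * suc y                ≤⟨ *-mono-≤ (+-mono-≤ 1≤N² (*-monoʳ-≤ 2 (*-mono-≤ p≤N p≤N)))
                                                     (+-mono-≤ (m^n>0 2 (L * 4)) y≤N⁴) ⟩
    (N * N + 2 * (N * N)) * (2 ^ (L * 4) + 2 ^ (L * 4)) ≡⟨ cong (λ z → (N * N + 2 * (N * N)) * (z + z)) (^-*-assoc 2 L 4) ⟨
    (N * N + 2 * (N * N)) * (N ^ 4 + N ^ 4)   ≤⟨ m≤m+n _ _ ⟩
    (N * N + 2 * (N * N)) * (N ^ 4 + N ^ 4) + N * N * (N ^ 4 + N ^ 4) ≡⟨ lemma N ⟩
    2 ^ 3 * N ^ 6                        ≡⟨ cong (2 ^ 3 *_) (^-*-assoc 2 L 6) ⟩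
    2 ^ 3 * 2 ^ (L * 6)                  ≡⟨ ^-distribˡ-+-* 2 3 (L * 6) ⟨
    2 ^ (3 + L * 6)                      ∎)
    where
    open ≤-Reasoning
    N : ℕ
    N = 2 ^ L
    1≤N² : 1 ≤ N * N
    1≤N² = *-mono-≤ (m^n>0 2 L) (m^n>0 2 L)
    p≤N : p ≤ N
    p≤N = ≤-trans (m≤n*m p 4) 4p≤N
    lemma : ∀ N → let N⁴ = N * (N * (N * (N * 1))) in
            (N * N + 2 * (N * N)) * (N⁴ + N⁴) + N * N * (N⁴ + N⁴) ≡ 8 * (N * (N * N⁴))
    lemma = solve-∀

-- Redundancy

2T²≤radix : ∀ p → 2 * (suc (slack (suc p)) * suc (slack (suc p))) ≤ radix (4 * p) 4
-- The added polynomial is the difference of the two sides; its coefficients are all nonnegative.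
2T²≤radix p = ≤-trans (m≤m+n _ (248 * (p * p * p * p) + 608 * (p * p * p) + 504 * (p * p) + 152 * p + 6)) (≤-reflexive (lemma p))
  where
  lemma : ∀ p → 2 * (suc (2 * (suc p * suc p)) * suc (2 * (suc p * suc p)))
                  + (248 * (p * p * p * p) + 608 * (p * p * p) + 504 * (p * p) + 152 * p + 6)
              ≡ 1 * suc (4 * p + 0) * suc (4 * p + 1) * suc (4 * p + 2) * suc (4 * p + 3)
  lemma = solve-∀

-- The two products in `p` differ by exactly 7, and this gain of order 1/p² outweighs the loss of
-- about 2/T. The 8 is the least constant that works at `p` = 0, where equality holds.
loss-telescopes : ∀ p → let T = suc (slack (suc p)) in
  suc T * suc T * ((1 + p) * (9 + p)) ≤ T * T * ((2 + p) * (8 + p))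
loss-telescopes p = ≤-trans (m≤m+n _ (24 * (p * p * p * p) + 64 * (p * p * p) + 73 * (p * p) + 26 * p)) (≤-reflexive (lemma p))
  where
  lemma : ∀ p → suc (suc (2 * (suc p * suc p))) * suc (suc (2 * (suc p * suc p))) * ((1 + p) * (9 + p))
                  + (24 * (p * p * p * p) + 64 * (p * p * p) + 73 * (p * p) + 26 * p)
              ≡ suc (2 * (suc p * suc p)) * suc (2 * (suc p * suc p)) * ((2 + p) * (8 + p))
  lemma = solve-∀

-- The factors (1 + 1/T)² are absorbed by the increasing bounded sequence (1+p)/(8+p).
chainLength-bound : ∀ p y →
  (8 + p) * 2 ^ chainLength p y ≤ 32 * (1 + p) * (suc y * (4 * p) !)
chainLength-bound zero y = begin
  8 * 2 ^ (width (roundingAt 0 y) + 0)       ≡⟨ cong (λ l → 8 * 2 ^ l) (+-identityʳ (width (roundingAt 0 y))) ⟩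
  8 * 2 ^ width (roundingAt 0 y)             ≤⟨ *-monoʳ-≤ 8 (tight (roundingAt 0 y)) ⟩
  -- Here T = 1, so C ≤ 2 and C + 1 is generously bounded by 4; this is the source of 32 = 8 · 4.
  8 * (suc (scale (roundingAt 0 y)) * suc y) ≤⟨ *-monoʳ-≤ 8 (*-monoˡ-≤ (suc y) (s≤s (m≤n⇒m≤1+n (c≤2t (roundingAt 0 y))))) ⟩
  8 * (4 * suc y)                      ≡⟨ lemma y ⟩
  32 * 1 * (suc y * 1)                 ∎
  where
  open ≤-Reasoning
  lemma : ∀ y → 8 * (4 * suc y) ≡ 32 * 1 * (suc y * 1)
  lemma = solve-∀
-- The factor `(8 + p) * (T * T)` clears the denominators of the induction hypothesis and of both
-- loss estimates.
chainLength-bound (suc p) y = *-cancelʳ-≤ _ _ ((8 + p) * (T * T)) (begin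
  (9 + p) * 2 ^ (M + l) * ((8 + p) * (T * T))
    ≡⟨ cong (λ z → (9 + p) * z * ((8 + p) * (T * T))) (^-distribˡ-+-* 2 M l) ⟩
  (9 + p) * (2 ^ M * 2 ^ l) * ((8 + p) * (T * T))
    ≡⟨ lemma₁ p (2 ^ M) (2 ^ l) (T * T) ⟩
  (9 + p) * (T * T * 2 ^ M) * ((8 + p) * 2 ^ l)
    ≤⟨ *-monoʳ-≤ ((9 + p) * (T * T * 2 ^ M)) (chainLength-bound p y′) ⟩
  (9 + p) * (T * T * 2 ^ M) * (32 * (1 + p) * (suc y′ * F))
    ≡⟨ lemma₂ p (T * T) (2 ^ M) (suc y′) F ⟩
  (9 + p) * (32 * (1 + p)) * F * (T * T * (2 ^ M * suc y′))
    ≤⟨ *-monoʳ-≤ ((9 + p) * (32 * (1 + p)) * F) (rounding-loss (roundingAt (suc p) y) (2T²≤radix p)) ⟩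
  (9 + p) * (32 * (1 + p)) * F * (suc T * suc T * (X * suc y))
    ≡⟨ lemma₃ p F (suc T * suc T) X (suc y) ⟩
  32 * (suc y * (F * X)) * (suc T * suc T * ((1 + p) * (9 + p)))
    ≤⟨ *-monoʳ-≤ (32 * (suc y * (F * X))) (loss-telescopes p) ⟩
  32 * (suc y * (F * X)) * (T * T * ((2 + p) * (8 + p)))
    ≡⟨ lemma₄ p (suc y) (F * X) (T * T) ⟩
  32 * (2 + p) * (suc y * (F * X)) * ((8 + p) * (T * T))
    ≡⟨ cong (λ z → 32 * (2 + p) * (suc y * z) * ((8 + p) * (T * T)))
         (trans (!*radix (4 * p) 4) (cong _! (trans (+-comm (4 * p) 4) (sym (*-suc 4 p))))) ⟩
  32 * (2 + p) * (suc y * (4 * suc p) !) * ((8 + p) * (T * T)) ∎)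
  where
  open ≤-Reasoning
  T M y′ l F X : ℕ
  T = suc (slack (suc p))
  M = width (roundingAt (suc p) y)
  y′ = nextSpill p y
  l = chainLength p y′
  F = (4 * p) !
  X = radix (4 * p) 4
  lemma₁ : ∀ p M l TT → (9 + p) * (M * l) * ((8 + p) * TT) ≡ (9 + p) * (TT * M) * ((8 + p) * l)
  lemma₁ = solve-∀
  lemma₂ : ∀ p TT M y F → (9 + p) * (TT * M) * (32 * (1 + p) * (y * F)) ≡ (9 + p) * (32 * (1 + p)) * F * (TT * (M * y))
  lemma₂ = solve-∀
  lemma₃ : ∀ p F SS X y → (9 + p) * (32 * (1 + p)) * F * (SS * (X * y)) ≡ 32 * (y * (F * X)) * (SS * ((1 + p) * (9 + p)))
  lemma₃ = solve-∀
  lemma₄ : ∀ p y FX TT → 32 * (y * FX) * (TT * ((2 + p) * (8 + p))) ≡ 32 * (2 + p) * (y * FX) * ((8 + p) * TT)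
  lemma₄ = solve-∀

-- Decoding by probes.

module Query {w : ℕ} .{{_ : NonZero w}} {A : Set} (κ : ℕ) where

  probeSpill : ∀ {d} → (p y o : ℕ) → (ℕ → DTree w A d) → DTree w A (suc κ + d)
  probeSpill p y o cont = probeWindow κ o (width (roundingAt p y)) λ m → cont (m / scale (roundingAt p y))

  -- Walking down the chain to block `i` only computes offsets. Probes occur at its own word, for
  -- the remainder, and at the following word, for the quotient.
  probeBlock : ∀ {d} → (p y o i : ℕ) → (ℕ → A) → DTree w A (suc κ + (suc κ + d))
  -- A default that is never reached when `i < p`.
  probeBlock zero    y o i g = leaf (g 0)
  probeBlock (suc p) y o i g with i ≟ p
  ... | no  _ = probeBlock p (nextSpill p y) (o + width (roundingAt (suc p) y)) i g
  ... | yes _ =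
    probeWindow κ o (width (roundingAt (suc p) y)) λ m →
    probeSpill p (nextSpill p y) (o + width (roundingAt (suc p) y)) λ k →
    leaf (g (k * scale (roundingAt (suc p) y) + m % scale (roundingAt (suc p) y)))

  module _ (L : ℕ) (budget : 3 + L * 6 ≤ κ * w) where
    open Widths L

    run-probeSpill : ∀ {d s} p {y k o} x (cont : ℕ → DTree w A d) (m : Vec Bool s) →
      4 * p ≤ 2 ^ L → y ≤ 2 ^ (L * 4) → k ≤ y → bitAt m ContainsAt o ∶ encodeChain p y k x →
      run (probeSpill p y o cont) m ≡ run (cont k) m
    run-probeSpill p {y} {k} {o} x cont m 4p≤ y≤ k≤y h = trans
      (run-probeWindow κ o (width (roundingAt p y)) (λ n → cont (n / scale (roundingAt p y))) m
        (≤-trans (width≤ p y 4p≤ y≤) budget))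
      (cong (λ n → run (cont n) m)
        (trans (cong (_/ scale (roundingAt p y)) (window-headWord {bitAt m} {o} p {y} {k} x k≤y h)) (headWord/scale p {y} {k} x)))

    -- The induction carries two invariants: `y ≤ 2 ^ (L * 4)` keeps each word within the probe
    -- budget, and `k ≤ y` makes its content fit into its width.
    run-probeBlock : ∀ {d s} p {y k o i} x (g : ℕ → A) (m : Vec Bool s) →
      (∀ j → x j ≤ radix (4 * j) 4) → 4 * p ≤ 2 ^ L → y ≤ 2 ^ (L * 4) → k ≤ y → i < p →
      bitAt m ContainsAt o ∶ encodeChain p y k x →
      run (probeBlock {d} p y o i g) m ≡ g (x i)
    run-probeBlock {d} (suc p) {y} {k} {o} {i} x g m x≤ 4p≤ y≤ k≤y i<1+p h with i ≟ p
    ... | no  i≢p  = run-probeBlock p x g m x≤ (≤-trans (*-monoʳ-≤ 4 (n≤1+n p)) 4p≤)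
      (nextSpill≤ p y 4p≤) (/-monoˡ-≤ _ (x≤ p)) (≤∧≢⇒< (s≤s⁻¹ i<1+p) i≢p)
      (containsAt-rest {bitAt m} {o} p {y} {k} x h)
    ... | yes refl = begin
      run (probeWindow κ o W afterHead) m
        ≡⟨ run-probeWindow κ o W afterHead m (≤-trans (width≤ (suc p) y 4p≤ y≤) budget) ⟩
      run (afterHead n) m
        ≡⟨ run-probeSpill p x (answer n) m (≤-trans (*-monoʳ-≤ 4 (n≤1+n p)) 4p≤) (nextSpill≤ p y 4p≤)
             (/-monoˡ-≤ C (x≤ p)) (containsAt-rest {bitAt m} {o} p {y} {k} x h) ⟩
      g (x p / C * C + n % C)
        ≡⟨ cong (λ r → g (x p / C * C + r)) (trans (cong (_% C) (window-headWord {bitAt m} {o} (suc p) {y} {k} x k≤y h))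
             ([m*n+o]%n≡o k (m%n<n (x p) C))) ⟩
      g (x p / C * C + x p % C)
        ≡⟨ cong g (m/n*n+m%n≡m (x p) C) ⟩
      g (x p) ∎
      where
      open ≡-Reasoning
      W C n : ℕ
      W = width (roundingAt (suc p) y)
      C = scale (roundingAt (suc p) y)
      n = window (bitAt m) o W
      answer : ℕ → ℕ → DTree w A d
      answer n k′ = leaf (g (k′ * C + n % C))
      afterHead : ℕ → DTree w A (suc κ + d)
      afterHead n = probeSpill p (nextSpill p y) (o + W) (answer n)

-- Interval representations as digit sequences.

module Structure (n : ℕ) where

  -- The topmost `n % 4` digits do not fill a block; packed together they serve as the spill that
  -- enters the chain.
  spillBound : ℕ
  spillBound = radix (4 * (n / 4)) (n % 4)

  space : ℕ
  space = chainLength (n / 4) spillBound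

  4*[n/4]+n%4≡n : 4 * (n / 4) + n % 4 ≡ n
  4*[n/4]+n%4≡n = trans (cong (_+ n % 4) (*-comm 4 (n / 4))) (m/n*n+m%n≡m n 4)

  space-bound : 2 ^ space ≤ 2 ^ 6 * n !
  space-bound = *-cancelˡ-≤ (8 + p) (begin
    -- `suc y ≤ y + y` doubles the constant 32, and `1 + p ≤ 8 + p` lets the factor `8 + p` cancel.
    (8 + p) * 2 ^ space                     ≤⟨ chainLength-bound p y ⟩
    32 * (1 + p) * (suc y * F)              ≤⟨ *-mono-≤ (*-monoʳ-≤ 32 (+-monoˡ-≤ p (s≤s (z≤n {7}))))
                                                        (*-monoˡ-≤ F (+-monoˡ-≤ y 1≤y)) ⟩
    32 * (8 + p) * ((y + y) * F)            ≡⟨ lemma p y F ⟩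
    (8 + p) * (64 * (F * y))                ≡⟨ cong (λ z → (8 + p) * (64 * z)) (trans (!*radix (4 * p) (n % 4)) (cong _! 4*[n/4]+n%4≡n)) ⟩
    (8 + p) * (64 * n !)                    ∎)
    where
    open ≤-Reasoning
    p y F : ℕ
    p = n / 4
    y = spillBound
    F = (4 * p) !
    1≤y : 1 ≤ y
    -- The radix is positive because the packing of zero digits lies below it.
    1≤y = ≤-trans (s≤s z≤n) (pack<radix {λ _ → 0} (λ _ → z≤n) (4 * p) (n % 4))
    lemma : ∀ p y F → 32 * (8 + p) * ((y + y) * F) ≡ (8 + p) * (64 * (F * y))
    lemma = solve-∀

  digit : UnivRep n → ℕ → ℕ
  digit R q with q <? n
  ... | yes q<n = toℕ (opposite (e R (opposite (fromℕ< q<n))))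
  -- The default 0 keeps `digit R q ≤ q` true for all `q`, as packing requires.
  ... | no  _   = 0

  toℕ-opposite-mono : ∀ {i j : Fin n} → toℕ i ≤ toℕ j → toℕ (opposite j) ≤ toℕ (opposite i)
  toℕ-opposite-mono {i} {j} i≤j rewrite opposite-prop i | opposite-prop j = ∸-monoʳ-≤ n (s≤s i≤j)

  digit≤ : ∀ R q → digit R q ≤ q
  digit≤ R q with q <? n
  ... | no  _   = z≤n
  ... | yes q<n = begin
    toℕ (opposite (e R v))  ≤⟨ toℕ-opposite-mono (e-ok R v) ⟩
    toℕ (opposite v)        ≡⟨ cong toℕ (opposite-involutive (fromℕ< q<n)) ⟩
    toℕ (fromℕ< q<n)        ≡⟨ toℕ-fromℕ< q<n ⟩
    q                       ∎
    where
    open ≤-Reasoning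
    v = opposite (fromℕ< q<n)

  digit-opposite : ∀ R u → digit R (toℕ (opposite u)) ≡ toℕ (opposite (e R u))
  digit-opposite R u with toℕ (opposite u) <? n
  ... | no  q≮n = contradiction (toℕ<n (opposite u)) q≮n
  ... | yes q<n = cong (toℕ ∘ opposite ∘ e R)
    (trans (cong opposite (fromℕ<-toℕ (opposite u) q<n)) (opposite-involutive u))

  blocks : UnivRep n → ℕ → ℕ
  blocks R j = pack (digit R) (4 * j) 4

  topSpill : UnivRep n → ℕ
  topSpill R = pack (digit R) (4 * (n / 4)) (n % 4)

  topSpill≤ : ∀ R → topSpill R ≤ spillBound
  topSpill≤ R = <⇒≤ (pack<radix (digit≤ R) (4 * (n / 4)) (n % 4))

  encodeRep : UnivRep n → Vec Bool space
  encodeRep R = encodeChain (n / 4) spillBound (topSpill R) (blocks R)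

  -- The point `v` itself is common to both intervals as soon as any point is. So a query needs a
  -- single right endpoint, that of the smaller vertex.
  adj⇔ : ∀ R {u v : Fin n} → toℕ u ≤ toℕ v → toℕ v ≤ toℕ (e R u) ⇔ Adj R u v
  adj⇔ R {u} {v} u≤v = mk⇔
    (λ v≤eu → toℕ v , (u≤v , v≤eu) , (≤-refl , e-ok R v))
    (λ (x , (_ , x≤eu) , (v≤x , _)) → ≤-trans v≤x x≤eu)

  Adj-sym : ∀ R {u v : Fin n} → Adj R u v → Adj R v u
  Adj-sym R (x , hu , hv) = x , hv , hu

  opposite-≤ᵇ⇔ : ∀ {i j : Fin n} → (toℕ (opposite i) ≤ᵇ toℕ (opposite j)) ≡ true ⇔ toℕ j ≤ toℕ i
  opposite-≤ᵇ⇔ {i} {j} = mk⇔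
    (λ h → subst (λ (i , j) → toℕ j ≤ toℕ i) (cong₂ _,_ (opposite-involutive i) (opposite-involutive j))
             (toℕ-opposite-mono (≤ᵇ⇒≤ _ _ (Equivalence.from T-≡ h))))
    (λ j≤i → Equivalence.to T-≡ (≤⇒≤ᵇ (toℕ-opposite-mono j≤i)))

  module _ {w : ℕ} .{{_ : NonZero w}} (κ : ℕ) (L : ℕ) (budget : 3 + L * 6 ≤ κ * w) (n≤2^L : n ≤ 2 ^ L) where
    open Query {w} {A = Bool} κ

    4p≤2^L : 4 * (n / 4) ≤ 2 ^ L
    4p≤2^L = ≤-trans (m+n≤o⇒m≤o _ (≤-reflexive 4*[n/4]+n%4≡n)) n≤2^L

    spillBound≤ : spillBound ≤ 2 ^ (L * 4)
    spillBound≤ = Widths.radix≤2^ L (<⇒≤ (m%n<n n 4)) (subst (_≤ 2 ^ L) (sym 4*[n/4]+n%4≡n) n≤2^L)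

    probeDigit : ℕ → (ℕ → Bool) → DTree w Bool (suc κ + (suc κ + 0))
    probeDigit q g with q <? 4 * (n / 4)
    ... | yes _ = probeBlock (n / 4) spillBound 0 (q / 4) λ x → g (unpack (4 * (q / 4)) 4 x (q % 4))
    -- A top digit is read from the first word alone; `leaf` fits any remaining probe allowance, so
    -- both branches have the same type.
    ... | no  _ = probeSpill (n / 4) spillBound 0 λ k → leaf (g (unpack (4 * (n / 4)) (n % 4) k (q ∸ 4 * (n / 4))))

    run-probeDigit : ∀ R {q} g → q < n → run (probeDigit q g) (encodeRep R) ≡ g (digit R q)
    run-probeDigit R {q} g q<n with q <? 4 * (n / 4)
    ... | yes q<4p = trans
      (run-probeBlock L budget (n / 4) (blocks R) _ (encodeRep R)
        (λ j → <⇒≤ (pack<radix (digit≤ R) (4 * j) 4)) 4p≤2^L spillBound≤ (topSpill≤ R)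
        (m<n*o⇒m/o<n (subst (q <_) (*-comm 4 (n / 4)) q<4p)) (λ _ → refl))
      (cong g (trans (unpack-pack (digit≤ R) (4 * (q / 4)) 4 (m%n<n q 4))
        (cong (digit R) (trans (cong (_+ q % 4) (*-comm 4 (q / 4))) (m/n*n+m%n≡m q 4)))))
    ... | no  q≮4p = trans
      (run-probeSpill L budget (n / 4) (blocks R)
        (λ k → leaf (g (unpack (4 * (n / 4)) (n % 4) k (q ∸ 4 * (n / 4))))) (encodeRep R)
        4p≤2^L spillBound≤ (topSpill≤ R) (λ _ → refl))
      (cong g (trans (unpack-pack (digit≤ R) (4 * (n / 4)) (n % 4) q-4p<r)
        (cong (digit R) (m+[n∸m]≡n (≮⇒≥ q≮4p)))))
      where
      q-4p<r : q ∸ 4 * (n / 4) < n % 4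
      q-4p<r = +-cancelˡ-< (4 * (n / 4)) _ _
        (subst (_< 4 * (n / 4) + n % 4) (sym (m+[n∸m]≡n (≮⇒≥ q≮4p))) (subst (q <_) (sym 4*[n/4]+n%4≡n) q<n))

    -- As n-1-i reverses the order of vertices, v ≤ e u is tested on reversed values.
    probeAdj : Fin n → Fin n → DTree w Bool (suc κ + (suc κ + 0))
    probeAdj u v with toℕ u ≤? toℕ v
    ... | yes _ = probeDigit (toℕ (opposite u)) (_≤ᵇ toℕ (opposite v))
    ... | no  _ = probeDigit (toℕ (opposite v)) (_≤ᵇ toℕ (opposite u))

    probeDigit-adj : ∀ R {u v} → toℕ u ≤ toℕ v →
      run (probeDigit (toℕ (opposite u)) (_≤ᵇ toℕ (opposite v))) (encodeRep R) ≡ true ⇔ Adj R u v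
    probeDigit-adj R {u} {v} u≤v =
      subst (λ b → b ≡ true ⇔ Adj R u v)
        (sym (trans (run-probeDigit R (_≤ᵇ toℕ (opposite v)) (toℕ<n (opposite u)))
                    (cong (_≤ᵇ toℕ (opposite v)) (digit-opposite R u))))
        (adj⇔ R u≤v ⇔-∘ opposite-≤ᵇ⇔)

    probeAdj-correct : ∀ R u v → run (probeAdj u v) (encodeRep R) ≡ true ⇔ Adj R u v
    probeAdj-correct R u v with toℕ u ≤? toℕ v
    ... | yes u≤v = probeDigit-adj R u≤v
    ... | no  u≰v = mk⇔ (Adj-sym R) (Adj-sym R) ⇔-∘ probeDigit-adj R (≰⇒≥ u≰v)

    adjStructure : AdjStructure n w space (suc κ + (suc κ + 0))
    adjStructure = record { encode = encodeRep ; query = probeAdj ; correct = probeAdj-correct }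

theorem4 : (a b : ℕ) → Σ ℕ λ c → Σ ℕ λ t → (n w : ℕ) → 1 ≤ w →
    ⌊log₂ n ⌋ ≤ a * w → w ≤ b * ⌊log₂ n ⌋ →
    Σ ℕ λ s → (2 ^ s ≤ 2 ^ c * (n !)) × AdjStructure n w s t
theorem4 a b = 6 , suc κ + (suc κ + 0) , λ n w 1≤w log≤aw _ →
  Structure.space n , Structure.space-bound n ,
  Structure.adjStructure n {{>-nonZero 1≤w}} κ (suc ⌊log₂ n ⌋) (budget n w 1≤w log≤aw)
    (<⇒≤ (n<2^[1+⌊log₂n⌋] n))
  where
  κ : ℕ
  -- With L = 1 + `⌊log₂ n ⌋` the word bound 3 + 6L is 9 + 6 `⌊log₂ n ⌋`, which is at most 9w + 6aw.
  κ = 9 + a * 6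
  budget : ∀ n w → 1 ≤ w → ⌊log₂ n ⌋ ≤ a * w → 9 + ⌊log₂ n ⌋ * 6 ≤ κ * w
  budget n w 1≤w log≤aw = begin
    9 + ⌊log₂ n ⌋ * 6      ≤⟨ +-mono-≤ (*-monoʳ-≤ 9 1≤w) (*-monoˡ-≤ 6 log≤aw) ⟩
    9 * w + a * w * 6      ≡⟨ lemma a w ⟩
    κ * w                  ∎
    where
    open ≤-Reasoning
    lemma : ∀ a w → 9 * w + a * w * 6 ≡ (9 + a * 6) * w
    lemma = solve-∀
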